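{- Let $\beta$ be a $\mathsf{TLCGA}$-bisimulation in a finite concurrent game model $\mathcal M=(S,\mathsf{Act},\mathfrak g,\mathsf{out},V)$. Then for any pair $s_1,s_2\in S$: $s_1\,\beta\,s_2$ holds if and only if $s_1$ and $s_2$ satisfy the same $\mathsf{TLCGA}$-formulae (in $\mathcal M$).
   Context: **Models.** Fix a finite set $\mathsf{Agt}$ of agents and a set $\mathsf{AP}$ of atomic propositions; a coalition is any subset of $\mathsf{Agt}$. A game form over an outcome set $O$ is $(\mathsf{Act},\mathsf{act},O,\mathsf{out})$ with $\mathsf{Act}\ne\emptyset$, $\mathsf{act}$ assigning to each agent $a$ a non-empty set $\mathsf{act}_a\subseteq\mathsf{Act}$, and $\mathsf{out}:\prod_{a\in\mathsf{Agt}}\mathsf{act}_a\to O$. A concurrent game model (game model) is $\mathcal M=(S,\mathsf{Act},\mathfrak g,\mathsf{out},V)$ with $S\neq\emptyset$ a set of states, $\mathsf{Act}\neq\emptyset$ a set of actions, $\mathfrak g$ assigning to each $w\in S$ a game form $(\mathsf{Act},\mathsf{act}_w,S,\mathsf{out}_w)$ over $S$, $\mathsf{out}$ the global outcome function $\mathsf{out}(w,\zeta)=\mathsf{out}_w(\zeta)$ determined by $\mathfrak g$, and $V:\mathsf{AP}\to\mathcal P(S)$. It is finite if $S$ and $\mathsf{Act}$ are finite. An action profile at $w$ is an element of $\prod_a\mathsf{act}_w(a)$. A history is a finite word $w_0\zeta_0w_1\cdots\zeta_{n-1}w_n$ ($n\ge 0$) with $w_i\in S$ and $\zeta_i$ an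 action profile at $w_i$. A strategy for $a$ maps each history ending in $w$ to an element of $\mathsf{act}_w(a)$; a strategy profile $\Sigma$ assigns a strategy to each agent. The play induced by $\Sigma$ at $w$ is $w_0\zeta_0w_1\zeta_1\cdots$ with $w_0=w$, $\zeta_n=\Sigma(w_0\zeta_0\cdots w_n)$, $w_{n+1}=\mathsf{out}_{w_n}(\zeta_n)$; its path is $w_0w_1w_2\cdots$. $\mathsf{paths}(w,\Sigma,C)$ is the set of paths of plays induced at $w$ by strategy profiles $\Sigma'$ that agree with $\Sigma$ on all agents in $C$. **Language $\mathsf{TLCGA}$.** State formulas: $\varphi::=p\mid\top\mid\neg\varphi\mid(\varphi\wedge\varphi)\mid(\varphi\vee\varphi)\mid\langle\![\gamma]\!\rangle$; path formulas: $\theta::=\mathsf X\varphi\mid\varphi\,\mathsf U\,\varphi\mid\mathsf G\varphi$; here $p\in\mathsf{AP}$ and $\gamma$ is a goal assignment, i.e. a map from $\mathcal P(\mathsf{Agt})$ to path formulas. The $\mathsf{TLCGA}$-formulae satisfied at states are the state formulas. **Semantics.** Booleans as usual. For a path $\pi=w_0w_1\cdots$: $\pi\Vdash\mathsf X\varphi$ iff $\varphi$ is true at $w_1$; $\pi\Vdash\varphi\,\mathsf U\,\psi$ iff for some $i$, $\psi$ is true at $w_i$ and $\varphi$ at all $w_j$, $j<i$; $\pi\Vdash\mathsf G\varphi$ iff $\varphi$ is true at all $w_i$. $\mathcal M,s\Vdash\langle\![\gamma]\!\rangle$ iff there is a strategy profile $\Sigma$ such that for every $C\subseteq\mathsf{Agt}$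 and every $\pi\in\mathsf{paths}(s,\Sigma,C)$, $\pi\Vdash\gamma(C)$. **Bisimulation.** For an action profile $\zeta$ at $w$ and a coalition $C$, $\mathsf{Out}[w,\zeta|_C]$ is the set of states $\mathsf{out}_w(\zeta')$ for action profiles $\zeta'$ at $w$ that agree with $\zeta$ on $C$. A relation $\beta\subseteq S^2$ is a $\mathsf{TLCGA}$-bisimulation in $\mathcal M$ if whenever $s_1\beta s_2$: (Atom equivalence) for all $p\in\mathsf{AP}$, $s_1\in V(p)$ iff $s_2\in V(p)$; (Forth) for every action profile $\zeta^1$ at $s_1$ there is an action profile $\zeta^2$ at $s_2$ such that for every coalition $C$ and every $u_2\in\mathsf{Out}[s_2,\zeta^2|_C]$ there is $u_1\in\mathsf{Out}[s_1,\zeta^1|_C]$ with $u_1\beta u_2$; (Back) for every action profile $\zeta^2$ at $s_2$ there is an action profile $\zeta^1$ at $s_1$ such that for every coalition $C$ and every $u_1\in\mathsf{Out}[s_1,\zeta^1|_C]$ there is $u_2\in\mathsf{Out}[s_2,\zeta^2|_C]$ with $u_1\beta u_2$.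
   Formalization: For an arbitrary bisimulation β the "if" direction is false (the empty relation is a bisimulation), so "s₁ β s₂" is replaced by "s₁ and s₂ are related by some bisimulation", i.e. β is read as the largest bisimulation. -}

module Defs where

open import Data.Fin.Base using (Fin)
open import Data.Fin.Subset using (Subset; _∈_)
open import Data.Irrelevant using ([_])
open import Data.Nat.Base using (ℕ; zero; suc; _<_)
open import Data.Product.Base using (∃; Σ-syntax; ∃-syntax; _×_; _,_; proj₁; proj₂)
open import Data.Refinement using (Refinement-syntax; value; _,_)
open import Data.Sum.Base using (_⊎_)
open import Data.Unit.Base using (⊤)
open import Data.Vec.Base using (Vec; lookup; tabulate)
open import Data.Vec.Properties using (lookup∘tabulate)
open import Function.Bundles using (_⇔_; _↔_)
open import Level using (0ℓ)
open import Relation.Binary.Core using (Rel)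
open import Relation.Binary.PropositionalEquality using (_≡_; subst; sym)
open import Relation.Nullary using (¬_)
open import Relation.Unary using (Pred; Satisfiable)

-- Throughout, the finite set of agents is Fin k.

Coalition : ℕ → Set
Coalition k = Subset k

-- The product of the sets A a over all agents a.  Tuples are vectors, and the
-- membership proofs are irrelevant, so that two tuples are (propositionally)
-- equal as soon as their components are; no function extensionality is needed.
Profile : ∀ {k} {Act : Set} → (Fin k → Pred Act 0ℓ) → Set
Profile {k} {Act} A = [ ζ ∈ Vec Act k ∣ (∀ a → A a (lookup ζ a)) ]

-- The non-emptiness of Act is a field of GameModel.
record GameForm (k : ℕ) (Act O : Set) : Set₁ where
  field
    act          : Fin k → Pred Act 0ℓ
    act-nonempty : ∀ a → Satisfiable (act a)
    out          : Profile act → O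

record GameModel (k : ℕ) (AP : Set) : Set₁ where
  field
    S            : Set
    S-nonempty   : S
    Act          : Set
    Act-nonempty : Act
    gameForm     : S → GameForm k Act S
    V            : AP → Pred S 0ℓ

  act : S → Fin k → Pred Act 0ℓ
  act w = GameForm.act (gameForm w)

  ActionProfile : S → Set
  ActionProfile w = Profile (act w)

  out : (w : S) → ActionProfile w → S
  out w = GameForm.out (gameForm w)

IsFinite : Set → Set
IsFinite A = ∃[ n ] (A ↔ Fin n)

FiniteModel : ∀ {k AP} → GameModel k AP → Set
FiniteModel M = IsFinite S × IsFinite Act
  where open GameModel M

module _ {k : ℕ} {AP : Set} (M : GameModel k AP) where
  open GameModel M

  -- History w: the words w₀ ζ₀ w₁ ⋯ ζₙ₋₁ wₙ with wₙ = w.  Nothing requires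
  -- wᵢ₊₁ to be the outcome of ζᵢ.
  data History : S → Set where
    start : (w : S) → History w
    snoc  : ∀ {w} → History w → ActionProfile w → (u : S) → History u

  Strategy : Fin k → Set
  Strategy a = ∀ {w} → History w → ∃ (act w a)

  StrategyProfile : Set
  StrategyProfile = (a : Fin k) → Strategy a

  -- The action profile Σ(h).
  choose : StrategyProfile → ∀ {w} → History w → ActionProfile w
  choose σ {w} h = tabulate actions , [ (λ a →
      subst (act w a) (sym (lookup∘tabulate actions a))
        (proj₂ (σ a h))) ]
    where
    actions : Fin k → Act
    actions a = proj₁ (σ a h)

  -- The prefix w₀ ζ₀ ⋯ wₙ of the play induced by σ at w.
  play : StrategyProfile → S → ℕ → ∃ History
  play σ w zero    = w , start w
  play σ w (suc n) with play σ w n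
  ... | wₙ , h = out wₙ (choose σ h) , snoc h (choose σ h) (out wₙ (choose σ h))

  Path : Set
  Path = ℕ → S

  inducedPath : StrategyProfile → S → Path
  inducedPath σ w n = proj₁ (play σ w n)

  -- Elements of act w a are compared as actions, ignoring membership proofs.
  StrategiesAgree : Coalition k → StrategyProfile → StrategyProfile → Set
  StrategiesAgree C σ σ′ = ∀ a → a ∈ C → ∀ {w} (h : History w) → proj₁ (σ a h) ≡ proj₁ (σ′ a h)

  paths : S → StrategyProfile → Coalition k → Pred Path 0ℓ
  paths w σ C π = ∃[ σ′ ] StrategiesAgree C σ σ′ × (∀ n → π n ≡ inducedPath σ′ w n)

  ProfilesAgree : ∀ {w} → Coalition k → ActionProfile w → ActionProfile w → Set
  ProfilesAgree C ζ ζ′ = ∀ a → a ∈ C → lookup (value ζ) a ≡ lookup (value ζ′) a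

  -- Out w ζ C is Out[w, ζ|_C].
  Out : (w : S) → ActionProfile w → Coalition k → Pred S 0ℓ
  Out w ζ C u = ∃[ ζ′ ] ProfilesAgree C ζ ζ′ × out w ζ′ ≡ u

  record IsBisimulation (β : Rel S 0ℓ) : Set where
    field
      atoms : ∀ {s₁ s₂} → β s₁ s₂ → ∀ p → V p s₁ ⇔ V p s₂
      forth : ∀ {s₁ s₂} → β s₁ s₂ →
              (ζ¹ : ActionProfile s₁) → Σ[ ζ² ∈ ActionProfile s₂ ]
              (∀ C u₂ → Out s₂ ζ² C u₂ → ∃[ u₁ ] Out s₁ ζ¹ C u₁ × β u₁ u₂)
      back  : ∀ {s₁ s₂} → β s₁ s₂ →
              (ζ² : ActionProfile s₂) → Σ[ ζ¹ ∈ ActionProfile s₁ ]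
              (∀ C u₁ → Out s₁ ζ¹ C u₁ → ∃[ u₂ ] Out s₂ ζ² C u₂ × β u₁ u₂)

mutual
  data Formula (k : ℕ) (AP : Set) : Set where
    atom    : AP → Formula k AP
    ⊤′      : Formula k AP
    ¬′_     : Formula k AP → Formula k AP
    _∧′_    : Formula k AP → Formula k AP → Formula k AP
    _∨′_    : Formula k AP → Formula k AP → Formula k AP
    ⟨[_]⟩   : (Coalition k → PathFormula k AP) → Formula k AP

  data PathFormula (k : ℕ) (AP : Set) : Set where
    X_  : Formula k AP → PathFormula k AP
    _U_ : Formula k AP → Formula k AP → PathFormula k AP
    G_  : Formula k AP → PathFormula k AP

module _ {k : ℕ} {AP : Set} (M : GameModel k AP) where
  open GameModel M

  mutual
    Sat : S → Formula k AP → Set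
    Sat s (atom p)  = V p s
    Sat s ⊤′        = ⊤
    Sat s (¬′ φ)    = ¬ Sat s φ
    Sat s (φ ∧′ ψ)  = Sat s φ × Sat s ψ
    Sat s (φ ∨′ ψ)  = Sat s φ ⊎ Sat s ψ
    Sat s ⟨[ γ ]⟩   = Σ[ σ ∈ StrategyProfile M ]
                      (∀ C π → paths M s σ C π → PathSat π (γ C))

    PathSat : Path M → PathFormula k AP → Set
    PathSat π (X φ)   = Sat (π 1) φ
    PathSat π (φ U ψ) = ∃[ i ] Sat (π i) ψ × (∀ j → j < i → Sat (π j) φ)
    PathSat π (G φ)   = ∀ i → Sat (π i) φ

  SameFormulae : Rel S 0ℓ
  SameFormulae s₁ s₂ = ∀ φ → Sat s₁ φ ⇔ Sat s₂ φ

{-# OPTIONS --safe #-}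

-- Invariance: a witnessing strategy profile at s₁ is copied to s₂ by translating
-- histories from s₂ to histories from s₁ along the Forth condition.  The twin
-- history may depend on the coalition C for which Forth is invoked, whereas the
-- strategy at s₂ may not.  Since histories record action profiles, each step can
-- use the largest coalition whose members follow the strategy in that step, and
-- this one choice serves all coalitions at once.
--
-- Completeness (Hennessy–Milner): finitely many states have characteristic
-- formulae.  A profile ζ at s₁ is matched at s₂ by the first move of a witness of
-- the goal assignment sending C to X χ_C, where χ_C is the disjunction of the
-- characteristic formulae of the states in Out[s₁,ζ|_C].

module Submission where

open import Defs
open import Axiom.DoubleNegationElimination using (em⇒dne)
open import Axiom.ExcludedMiddle using (ExcludedMiddle)
open import Data.Empty using (⊥-elim)
open import Data.Fin.Base using (Fin; zero; suc)
import Data.Fin.Subset as Subset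
open import Data.Fin.Subset.Properties using (_∈?_)
open import Data.Irrelevant using ([_])
open import Data.Maybe.Base using (Maybe; just; nothing; map)
open import Data.Nat.Base using (ℕ; zero; suc)
open import Data.Product.Base using (Σ-syntax; ∃-syntax; _×_; _,_; proj₁; proj₂)
open import Data.Refinement using (value; _,_)
open import Data.Refinement.Properties using (value-injective)
open import Data.Sum.Base using (inj₁; inj₂)
open import Data.Unit.Base using (tt)
open import Data.Vec.Base using (Vec; lookup; tabulate)
open import Data.Vec.Properties
  using (lookup∘tabulate; tabulate∘lookup; tabulate-cong; []=⇒lookup; lookup⇒[]=)
open import Data.Vec.Functional using (foldr)
open import Function.Base using (_∘_; flip)
open import Function.Bundles using (_⇔_; mk⇔; Equivalence; Inverse)
open import Function.Construct.Symmetry using (⇔-sym)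
open import Level using (0ℓ)
open import Relation.Binary.Core using (Rel)
open import Relation.Binary.PropositionalEquality
  using (_≡_; refl; sym; trans; cong; subst)
open import Relation.Nullary using (¬_; yes; no; does; contradiction; recompute)
open import Relation.Nullary.Decidable using (dec-true)
open import Relation.Unary using (Pred; Decidable)

open Equivalence using (to; from)

⟪_⟫ : ∀ {n} {P : Pred (Fin n) 0ℓ} → Decidable P → Subset.Subset n
⟪ P? ⟫ = tabulate (does ∘ P?)

∈⟪⟫⁻ : ∀ {n} {P : Pred (Fin n) 0ℓ} (P? : Decidable P) {i} → i Subset.∈ ⟪ P? ⟫ → P i
∈⟪⟫⁻ P? {i} i∈ with P? i | trans (sym (lookup∘tabulate (does ∘ P?) i)) ([]=⇒lookup i∈)
... | yes p | _ = p
... | no _  | ()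

∈⟪⟫⁺ : ∀ {n} {P : Pred (Fin n) 0ℓ} (P? : Decidable P) {i} → P i → i Subset.∈ ⟪ P? ⟫
∈⟪⟫⁺ P? {i} p =
  lookup⇒[]= i _ (trans (lookup∘tabulate (does ∘ P?) i) (dec-true (P? i) p))

lookup-ext : ∀ {A : Set} {n} {xs ys : Vec A n} → (∀ i → lookup xs i ≡ lookup ys i) → xs ≡ ys
lookup-ext {xs = xs} {ys} eq =
  trans (sym (tabulate∘lookup xs)) (trans (tabulate-cong eq) (tabulate∘lookup ys))

flip-bisimulation : ∀ {k AP} {M : GameModel k AP} {β} → IsBisimulation M β → IsBisimulation M (flip β)
flip-bisimulation bis = record
  { atoms = λ b p → ⇔-sym (atoms b p)
  ; forth = back
  ; back  = forth
  }
  where open IsBisimulation bis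

module _ (em : ExcludedMiddle 0ℓ) {k : ℕ} {AP : Set} (M : GameModel k AP) where
  open GameModel M

  -- Building strategy profiles and deviations from them.

  lookup-choose : ∀ σ {w} (h : History M w) a → lookup (value (choose M σ h)) a ≡ proj₁ (σ a h)
  lookup-choose σ h a = lookup∘tabulate _ a

  length : ∀ {w} → History M w → ℕ
  length (start w)    = zero
  length (snoc h ζ u) = suc (length h)

  fromJoint : (∀ {w} → History M w → ActionProfile w) → StrategyProfile M
  fromJoint f a h with f h
  -- A profile holds membership irrelevantly, a strategy must return a real proof; excluded middle
  -- decides membership, so the proof can be recomputed.
  ... | ζ , [ p ] = lookup ζ a , recompute em (p a)

  choose-fromJoint : ∀ (f : ∀ {w} → History M w → ActionProfile w) {w} (h : History M w) →
                     choose M (fromJoint f) h ≡ f h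
  choose-fromJoint f h = value-injective (lookup-ext (lookup-choose (fromJoint f) h))

  mix : Coalition k → StrategyProfile M → StrategyProfile M → StrategyProfile M
  mix C σ τ a h with a ∈? C
  ... | yes _ = σ a h
  ... | no  _ = τ a h

  mix-agree : ∀ C σ τ → StrategiesAgree M C σ (mix C σ τ)
  mix-agree C σ τ a a∈C h with a ∈? C
  ... | yes _  = refl
  ... | no a∉C = contradiction a∈C a∉C

  -- On `C` the profiles agree by hypothesis, and off `C` the mix follows `τ` anyway. So `τ` may
  -- prescribe a complete profile for a deviation of the agents outside `C`.
  choose-mix : ∀ C σ τ {w} (h : History M w) →
               ProfilesAgree M C (choose M σ h) (choose M τ h) →
               choose M (mix C σ τ) h ≡ choose M τ h
  choose-mix C σ τ h agree = value-injective (lookup-ext λ a →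
    trans (lookup-choose (mix C σ τ) h a) (trans (pointwise a) (sym (lookup-choose τ h a))))
    where
    pointwise : ∀ a → proj₁ (mix C σ τ a h) ≡ proj₁ (τ a h)
    pointwise a with a ∈? C
    ... | yes a∈C = trans (sym (lookup-choose σ h a)) (trans (agree a a∈C) (lookup-choose τ h a))
    ... | no  _   = refl

  choose-agree : ∀ {C σ τ} → StrategiesAgree M C σ τ → ∀ {w} (h : History M w) →
                 ProfilesAgree M C (choose M σ h) (choose M τ h)
  choose-agree {C} {σ} {τ} agree h a a∈C =
    trans (lookup-choose σ h a) (trans (agree a a∈C h) (sym (lookup-choose τ h a)))

  arbitrary : StrategyProfile M
  arbitrary a {w} _ = GameForm.act-nonempty (gameForm w) a

  -- A strategy must answer every history, so the one intended move `ζ` is padded with arbitrary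
  -- legal moves.
  override : ∀ u → ActionProfile u → ∀ {w} → History M w → ActionProfile w
  override u ζ {w} h with em {w ≡ u}
  ... | yes refl = ζ
  ... | no  _    = choose M arbitrary h

  override-self : ∀ u ζ (h : History M u) → override u ζ h ≡ ζ
  override-self u ζ h with em {u ≡ u}
  ... | yes refl = refl
  ... | no  u≢u  = contradiction refl u≢u

  -- Copying a strategy profile along a bisimulation.

  module Transfer {β : Rel S 0ℓ} (bis : IsBisimulation M β)
                  {s₁ s₂ : S} (s₁βs₂ : β s₁ s₂) (σ₁ : StrategyProfile M) where
    open IsBisimulation bis

    -- Forth for the largest coalition on which ζ agrees with the answer to ζ¹.
    forth-max : ∀ {w₁ w₂} (b : β w₁ w₂) (ζ¹ : ActionProfile w₁) (ζ : ActionProfile w₂) →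
                Σ[ ζ′ ∈ ActionProfile w₁ ]
                (∀ a → lookup (value (proj₁ (forth b ζ¹))) a ≡ lookup (value ζ) a →
                       lookup (value ζ¹) a ≡ lookup (value ζ′) a)
                × β (out w₁ ζ′) (out w₂ ζ)
    forth-max {w₂ = w₂} b ζ¹ ζ
      with proj₂ (forth b ζ¹) ⟪ same? ⟫ (out w₂ ζ) (ζ , (λ a → ∈⟪⟫⁻ same?) , refl)
      where
      same? : Decidable (λ a → lookup (value (proj₁ (forth b ζ¹))) a ≡ lookup (value ζ) a)
      same? a = em
    ... | _ , (ζ′ , agree , refl) , b′ = ζ′ , (λ a → agree a ∘ ∈⟪⟫⁺ (λ _ → em)) , b′

    -- The whole history is kept, since `σ₁` may depend on all of it.
    record Twin (w₂ : S) : Set where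
      constructor twin
      field
        {state} : S
        history : History M state
        related : β state w₂

    open Twin

    respond : ∀ {w} → Twin w → ActionProfile w
    respond (twin h b) = proj₁ (forth b (choose M σ₁ h))

    mirror : ∀ {w} (t : Twin w) → ActionProfile w → ActionProfile (state t)
    mirror (twin h b) ζ = proj₁ (forth-max b (choose M σ₁ h) ζ)

    -- No coalition is fixed: whoever obeys `respond t` in `ζ` obeys `σ₁` in the mirrored profile.
    -- Hence `σ₂` can be chosen before the coalition is known.
    mirror-agree : ∀ {w} (t : Twin w) ζ a → lookup (value (respond t)) a ≡ lookup (value ζ) a →
                   lookup (value (choose M σ₁ (history t))) a ≡ lookup (value (mirror t ζ)) a
    mirror-agree (twin h b) ζ = proj₁ (proj₂ (forth-max b (choose M σ₁ h) ζ))

    step : ∀ {w} → Twin w → (ζ : ActionProfile w) → Twin (out w ζ)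
    step t@(twin h b) ζ =
      twin (snoc h (mirror t ζ) _) (proj₂ (proj₂ (forth-max b (choose M σ₁ h) ζ)))

    initial : Twin s₂
    initial = twin (start s₁) s₁βs₂

    -- Only plays from s₂ have twins: other words need not follow the outcome function.
    translate : ∀ {w} → History M w → Maybe (Twin w)
    translate (start w) with em {w ≡ s₂}
    ... | yes refl = just initial
    ... | no  _    = nothing
    translate (snoc {w} h ζ u) with em {u ≡ out w ζ}
    ... | yes refl = map (λ t → step t ζ) (translate h)
    ... | no  _    = nothing

    translate-start : translate (start s₂) ≡ just initial
    translate-start with em {s₂ ≡ s₂}
    ... | yes refl = refl
    ... | no  s≢s  = contradiction refl s≢s

    translate-snoc : ∀ {w} (h : History M w) ζ →
                     translate (snoc h ζ (out w ζ)) ≡ map (λ t → step t ζ) (translate h)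
    translate-snoc {w} h ζ with em {out w ζ ≡ out w ζ}
    ... | yes refl = refl
    ... | no  o≢o  = contradiction refl o≢o

    response : ∀ {w} → History M w → ActionProfile w
    response h with translate h
    ... | just t  = respond t
    -- Histories without a twin are not prefixes of plays from `s₂`, so any legal profile will do.
    ... | nothing = choose M arbitrary h

    response-translate : ∀ {w} (h : History M w) {t} → translate h ≡ just t → response h ≡ respond t
    response-translate h eq with translate h
    response-translate h refl | just _ = refl

    σ₂ : StrategyProfile M
    σ₂ = fromJoint response

    -- Matching a path open to `C` at `s₂` by one at `s₁`.

    module Simulate (C : Coalition k) (σ′ : StrategyProfile M)
                    (agree : StrategiesAgree M C σ₂ σ′) where

      hist₂ : ∀ n → History M (inducedPath M σ′ s₂ n)
      hist₂ n = proj₂ (play M σ′ s₂ n)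

      twins : ∀ n → Twin (inducedPath M σ′ s₂ n)
      twins zero    = initial
      twins (suc n) = step (twins n) (choose M σ′ (hist₂ n))

      translate-play : ∀ n → translate (hist₂ n) ≡ just (twins n)
      translate-play zero    = translate-start
      translate-play (suc n) =
        trans (translate-snoc (hist₂ n) _) (cong (map _) (translate-play n))

      length-twins : ∀ n → length (history (twins n)) ≡ n
      length-twins zero    = refl
      length-twins (suc n) = cong suc (length-twins n)

      move : ∀ n → ActionProfile (state (twins n))
      move n = mirror (twins n) (choose M σ′ (hist₂ n))

      -- The stage of the simulated play is read off from the length of the history, so histories
      -- need not be compared.
      script : ∀ {w} → History M w → ActionProfile w
      script h = override (state (twins (length h))) (move (length h)) h

      script-twins : ∀ n → script (history (twins n)) ≡ move n
      script-twins n = helper (length-twins n)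
        where
        helper : ∀ {m} → m ≡ n → override (state (twins m)) (move m) (history (twins n)) ≡ move n
        helper refl = override-self _ (move n) (history (twins n))

      σ : StrategyProfile M
      σ = mix C σ₁ (fromJoint script)

      choose-script : ∀ n → choose M (fromJoint script) (history (twins n)) ≡ move n
      choose-script n = trans (choose-fromJoint script (history (twins n))) (script-twins n)

      respond-agree : ∀ n → ProfilesAgree M C (respond (twins n)) (choose M σ′ (hist₂ n))
      respond-agree n = subst (λ ζ → ProfilesAgree M C ζ (choose M σ′ (hist₂ n)))
        (trans (choose-fromJoint response (hist₂ n)) (response-translate (hist₂ n) (translate-play n)))
        (choose-agree {C} {σ₂} {σ′} agree (hist₂ n))

      -- Members of `C` follow `σ₂` in `σ′`, so their mirrored moves are those of `σ₁`; mixing `σ₁`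
      -- into the script therefore leaves `move n` unchanged.
      choose-twins : ∀ n → choose M σ (history (twins n)) ≡ move n
      choose-twins n = trans
        (choose-mix C σ₁ (fromJoint script) (history (twins n))
          (subst (ProfilesAgree M C (choose M σ₁ (history (twins n)))) (sym (choose-script n))
            (λ a a∈C → mirror-agree (twins n) _ a (respond-agree n a a∈C))))
        (choose-script n)

      -- Histories are matched along with states because the next move of `σ` depends on them.
      play-twins : ∀ n → play M σ s₁ n ≡ (state (twins n) , history (twins n))
      play-twins zero    = refl
      play-twins (suc n) rewrite play-twins n | choose-twins n = refl

      path-related : ∀ n → β (inducedPath M σ s₁ n) (inducedPath M σ′ s₂ n)
      path-related n =
        subst (λ s → β s _) (sym (cong proj₁ (play-twins n))) (related (twins n))

    simulate : ∀ C π₂ → paths M s₂ σ₂ C π₂ → ∃[ π₁ ] paths M s₁ σ₁ C π₁ × (∀ n → β (π₁ n) (π₂ n))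
    simulate C π₂ (σ′ , agree , π₂≗) =
      inducedPath M σ s₁ ,
      (σ , mix-agree C σ₁ (fromJoint script) , λ _ → refl) ,
      λ n → subst (β _) (sym (π₂≗ n)) (path-related n)
      where open Simulate C σ′ agree

  -- Invariance of formulae under bisimulation.

  mutual
    invariance : ∀ {β} → IsBisimulation M β → ∀ φ {s₁ s₂} → β s₁ s₂ → Sat M s₁ φ → Sat M s₂ φ
    invariance bis (atom p) b = to (IsBisimulation.atoms bis b p)
    invariance bis ⊤′       b = λ _ → tt
    -- Negation reverses the direction, hence the converse relation and the quantification over all
    -- `β`.
    invariance bis (¬′ φ)   b ¬φ = ¬φ ∘ invariance (flip-bisimulation bis) φ b
    invariance bis (φ ∧′ ψ) b (x , y) = invariance bis φ b x , invariance bis ψ b y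
    invariance bis (φ ∨′ ψ) b (inj₁ x) = inj₁ (invariance bis φ b x)
    invariance bis (φ ∨′ ψ) b (inj₂ y) = inj₂ (invariance bis ψ b y)
    invariance bis ⟨[ γ ]⟩  b (σ₁ , win) = σ₂ , λ C π₂ π₂∈ →
      let π₁ , π₁∈ , rel = simulate C π₂ π₂∈
      in path-invariance bis (γ C) rel (win C π₁ π₁∈)
      where open Transfer bis b σ₁

    path-invariance : ∀ {β} → IsBisimulation M β → ∀ θ {π₁ π₂} → (∀ n → β (π₁ n) (π₂ n)) →
                      PathSat M π₁ θ → PathSat M π₂ θ
    path-invariance bis (X φ)   rel x = invariance bis φ (rel 1) x
    path-invariance bis (φ U ψ) rel (i , y , x) =
      i , invariance bis ψ (rel i) y , λ j j<i → invariance bis φ (rel j) (x j j<i)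
    path-invariance bis (G φ)   rel x = λ i → invariance bis φ (rel i) (x i)

  ⋀ ⋁ : ∀ {n} → (Fin n → Formula k AP) → Formula k AP
  ⋀ = foldr _∧′_ ⊤′
  ⋁ = foldr _∨′_ (¬′ ⊤′)

  ⋀⁺ : ∀ {n s} (φ : Fin n → Formula k AP) → (∀ i → Sat M s (φ i)) → Sat M s (⋀ φ)
  ⋀⁺ {zero}  φ x = tt
  ⋀⁺ {suc n} φ x = x zero , ⋀⁺ (φ ∘ suc) (x ∘ suc)

  ⋀⁻ : ∀ {n s} (φ : Fin n → Formula k AP) → Sat M s (⋀ φ) → ∀ i → Sat M s (φ i)
  ⋀⁻ φ (x , xs) zero    = x
  ⋀⁻ φ (x , xs) (suc i) = ⋀⁻ (φ ∘ suc) xs i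

  ⋁⁺ : ∀ {n s} (φ : Fin n → Formula k AP) i → Sat M s (φ i) → Sat M s (⋁ φ)
  ⋁⁺ φ zero    x = inj₁ x
  ⋁⁺ φ (suc i) x = inj₂ (⋁⁺ (φ ∘ suc) i x)

  ⋁⁻ : ∀ {n s} (φ : Fin n → Formula k AP) → Sat M s (⋁ φ) → ∃[ i ] Sat M s (φ i)
  ⋁⁻ {zero}  φ x        = ⊥-elim (x tt)
  ⋁⁻ {suc n} φ (inj₁ x) = zero , x
  ⋁⁻ {suc n} φ (inj₂ x) = let i , y = ⋁⁻ (φ ∘ suc) x in suc i , y

  separate : ∀ u v → ∃[ φ ] Sat M u φ × (Sat M v φ → SameFormulae M u v)
  separate u v with em {∃[ φ ] Sat M u φ × ¬ Sat M v φ}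
  ... | yes (φ , x , ¬y) = φ , x , λ y → contradiction y ¬y
  -- If every formula true at `u` holds at `v`, applying this to negations gives the converse
  -- inclusion.
  ... | no  inseparable  = ⊤′ , tt , λ _ φ → mk⇔ (u⇒v φ)
          (λ y → em⇒dne em λ ¬x → u⇒v (¬′ φ) ¬x y)
    where
    u⇒v : ∀ φ → Sat M u φ → Sat M v φ
    u⇒v φ x = em⇒dne em λ ¬y → inseparable (φ , x , ¬y)

  -- Logical equivalence is a bisimulation.

  module HennessyMilner (S-finite : IsFinite S) where
    open Inverse (proj₂ S-finite) using ()
      renaming (to to index; from to state; strictlyInverseʳ to state∘index)

    -- Conjoin the formulae separating `u` from each state; a state `v` satisfying its own conjunct
    -- must be equivalent to `u`.
    characteristic : ∀ u → ∃[ φ ] Sat M u φ × (∀ v → Sat M v φ → SameFormulae M u v)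
    characteristic u =
      ⋀ χ , ⋀⁺ χ (λ i → proj₁ (proj₂ (separate u (state i)))) , λ v x →
        subst (SameFormulae M u) (state∘index v)
          (proj₂ (proj₂ (separate u (state (index v))))
            (subst (λ s → Sat M s (χ (index v))) (sym (state∘index v)) (⋀⁻ χ x (index v))))
      where
      χ : Fin (proj₁ S-finite) → Formula k AP
      χ i = proj₁ (separate u (state i))

    -- `P` need not be closed under equivalence, so satisfaction yields only an equivalent member of
    -- `P`, which is what Forth for `SameFormulae` asks.
    define : ∀ (P : Pred S 0ℓ) → ∃[ φ ] (∀ {u} → P u → Sat M u φ)
             × (∀ {v} → Sat M v φ → ∃[ u ] P u × SameFormulae M u v)
    define P =
      ⋁ (proj₁ ∘ member) ,
      (λ {u} Pu → ⋁⁺ (proj₁ ∘ member) (index u)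
        (subst (λ s → Sat M s (proj₁ (member (index u)))) (state∘index u)
          (proj₁ (proj₂ (member (index u))) (subst P (sym (state∘index u)) Pu)))) ,
      λ x → let i , y = ⋁⁻ (proj₁ ∘ member) x in state i , proj₂ (proj₂ (member i)) y
      where
      member : ∀ i → ∃[ φ ] (P (state i) → Sat M (state i) φ)
               × (∀ {v} → Sat M v φ → P (state i) × SameFormulae M (state i) v)
      member i with em {P (state i)} | characteristic (state i)
      ... | yes p | φ , x , same = φ , (λ _ → x) , λ y → p , same _ y
      ... | no ¬p | _            = ¬′ ⊤′ , (λ p → contradiction p ¬p) , λ y → ⊥-elim (y tt)

    -- Let the agents outside `C` play `ζ′` in the first step; later moves do not affect `π 1`.
    out-path : ∀ {s σ} {ζ : ActionProfile s} {C u} → choose M σ (start s) ≡ ζ → Out M s ζ C u →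
               ∃[ π ] paths M s σ C π × π 1 ≡ u
    out-path {s} {σ} {ζ} {C} refl (ζ′ , agree , refl) =
      inducedPath M (mix C σ τ) s , (mix C σ τ , mix-agree C σ τ , λ _ → refl) ,
      cong (out s) (trans
        (choose-mix C σ τ (start s) (subst (ProfilesAgree M C ζ) (sym choose-τ) agree)) choose-τ)
      where
      τ : StrategyProfile M
      τ = fromJoint (override s ζ′)

      choose-τ : choose M τ (start s) ≡ ζ′
      choose-τ = trans (choose-fromJoint (override s ζ′) (start s)) (override-self s ζ′ (start s))

    path-out : ∀ {s σ C π} → paths M s σ C π → Out M s (choose M σ (start s)) C (π 1)
    path-out {s} {σ} {C} (σ′ , agree , π≗) =
      choose M σ′ (start s) , choose-agree {C} {σ} {σ′} agree (start s) , sym (π≗ 1)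

    forth-same : ∀ {s₁ s₂} → SameFormulae M s₁ s₂ → (ζ¹ : ActionProfile s₁) →
                 Σ[ ζ² ∈ ActionProfile s₂ ]
                 (∀ C u₂ → Out M s₂ ζ² C u₂ → ∃[ u₁ ] Out M s₁ ζ¹ C u₁ × SameFormulae M u₁ u₂)
    forth-same {s₁} {s₂} same ζ¹ = choose M σ₂ (start s₂) , λ C u₂ u₂∈ →
      let π , π∈ , π1≡u₂ = out-path {σ = σ₂} refl u₂∈
      in proj₂ (proj₂ (define (Out M s₁ ζ¹ C)))
           (subst (λ s → Sat M s (χ C)) π1≡u₂ (win₂ C π π∈))
      where
      χ : Coalition k → Formula k AP
      χ C = proj₁ (define (Out M s₁ ζ¹ C))

      σ₁ : StrategyProfile M
      σ₁ = fromJoint (override s₁ ζ¹)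

      choose-σ₁ : choose M σ₁ (start s₁) ≡ ζ¹
      choose-σ₁ =
        trans (choose-fromJoint (override s₁ ζ¹) (start s₁)) (override-self s₁ ζ¹ (start s₁))

      goal₂ : Sat M s₂ ⟨[ (λ C → X χ C) ]⟩
      -- At `s₁` the profile opening with `ζ¹` meets every goal, because the second state of a path
      -- open to `C` lies in `Out M s₁ ζ¹ C`.
      goal₂ = to (same ⟨[ (λ C → X χ C) ]⟩) (σ₁ , λ C π π∈ → proj₁ (proj₂ (define (Out M s₁ ζ¹ C)))
        (subst (λ ζ → Out M s₁ ζ C (π 1)) choose-σ₁ (path-out {σ = σ₁} π∈)))

      σ₂ : StrategyProfile M
      σ₂ = proj₁ goal₂

      win₂ : ∀ C π → paths M s₂ σ₂ C π → Sat M (π 1) (χ C)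
      win₂ = proj₂ goal₂

    same-sym : ∀ {u v} → SameFormulae M u v → SameFormulae M v u
    same-sym same φ = ⇔-sym (same φ)

    same-bisimulation : IsBisimulation M (SameFormulae M)
    same-bisimulation = record
      { atoms = λ same p → same (atom p)
      ; forth = forth-same
      ; back  = λ same ζ² →
          let ζ¹ , match = forth-same (same-sym same) ζ²
          in ζ¹ , λ C u₁ u₁∈ → let u₂ , u₂∈ , same′ = match C u₁ u₁∈ in u₂ , u₂∈ , same-sym same′
      }

-- The bisimulation is existentially bound: a fixed one, such as the empty relation, may fail to
-- relate equivalent states.
proposition8 : ExcludedMiddle 0ℓ →
    (k : ℕ) (AP : Set) (M : GameModel k AP) → FiniteModel M →
    (s₁ s₂ : GameModel.S M) →
    (∃[ β ] IsBisimulation M β × β s₁ s₂) ⇔ SameFormulae M s₁ s₂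
proposition8 em k AP M (S-finite , _) s₁ s₂ = mk⇔
  (λ (β , bis , b) φ → mk⇔ (invariance em M bis φ b) (invariance em M (flip-bisimulation bis) φ b))
  (λ same → SameFormulae M , HennessyMilner.same-bisimulation em M S-finite , same)
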